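{- Let $G$ be a finite partial cube with the opposite-semicube Helly property. Then $G$ is antipodal if and only if $G$ is opposite-semicube-isomorphic.
   Context: All graphs are undirected, connected, simple and finite; $d_G$ is the usual shortest-path distance. A partial cube is a graph isomorphic to an isometric subgraph of some hypercube (a subgraph $H$ of $Q$ is isometric if $d_H(x,y)=d_Q(x,y)$ for all $x,y\in V(H)$). The Djokovi\'c–Winkler relation on $E(G)$ is: $uv\,\Theta\,xy$ iff $d_G(u,x)+d_G(v,y)\ne d_G(u,y)+d_G(v,x)$; in a partial cube it is an equivalence relation, and its classes $E_1,\dots,E_d$ are the $\Theta$-classes. For a $\Theta$-class $E_i$ and an edge $xy\in E_i$, the two (opposite) semicubes associated with $E_i$ are $W_i^0=\{a\in V(G): d_G(x,a)<d_G(y,a)\}$ and $W_i^1=\{a\in V(G): d_G(y,a)<d_G(x,a)\}$ (independent of the choice of $xy\in E_i$ up to interchanging the labels $0,1$; they partition $V(G)$). For $x\in V(G)$, $W_i(x)$ denotes the one of $W_i^0,W_i^1$ containing $x$, and $W_i^*(x)$ the other one. $G$ is opposite-semicube-isomorphic if $G[W_i^0]\cong G[W_i^1]$ (induced subgraphs) for every $i\in\{1,\dots,d\}$. $G$ has the opposite-semicube Helly property if for every $x\in V(G)$: whenever $W_i^*(x)\cap W_j^*(x)\ne\emptyset$ for all $1\le i,j\le d$ with $i\ne j$, we have $\bigcap_{i=1}^d W_i^*(x)\ne\emptyset$. A vertex $y$ is a relative antipode of $x$ in $G$ if $d_G(x,y)\ge d_G(x,z)$ for every neighbor $z$ of $y$.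 $G$ is antipodal if every vertex has exactly one relative antipode. -}

module Defs where

open import Data.Bool.Base using (Bool)
open import Data.Fin.Base using (Fin)
open import Data.Fin.Properties using (any?; _≟_)
open import Data.Nat.Base using (ℕ; zero; suc; _+_; _≤_; _<_; z≤n; s≤s)
open import Data.Product using (∃; _×_; _,_; proj₁; proj₂; ∃!)
open import Data.Refinement using (Refinement-syntax; value)
open import Data.Sum.Base using (_⊎_)
open import Data.Vec.Base using (Vec; lookup)
open import Function.Base using (_∘_)
open import Function.Bundles using (_↔_; _⇔_; Inverse)
open import Function.Properties.Inverse using (↔⇒↣)
open import Relation.Binary.Core using (Rel)
open import Relation.Binary.Definitions using (Symmetric; Irreflexive; DecidableEquality)
  renaming (Decidable to Decidable₂)
open import Relation.Binary.PropositionalEquality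
  using (_≡_; _≢_; refl; sym; subst; ≢-sym)
open import Relation.Nullary using (¬_; Dec; yes; no; contradiction)
open import Relation.Nullary.Decidable using (map′; _×-dec_; via-injection)
open import Relation.Unary using (Pred; Decidable; Satisfiable; _∈_; _∩_; ⋂)
open import Level using (0ℓ)

record Graph : Set₁ where
  infix 4 _~_
  field
    V        : Set
    _~_      : Rel V 0ℓ
    ~-sym    : Symmetric _~_
    ~-irrefl : Irreflexive _≡_ _~_

infix 4 _≅_
record _≅_ (G H : Graph) : Set where
  private
    module G = Graph G
    module H = Graph H
  field
    vertices : G.V ↔ H.V
  open Inverse vertices public using (to; from)
  field
    edges : ∀ u v → (u G.~ v) ⇔ (to u H.~ to v)

-- A subgraph need not be induced: its vertices satisfy the predicate W, and
-- its edge relation is any symmetric relation on them contained in that of G.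
record Subgraph (G : Graph) : Set₁ where
  open Graph G
  field
    W     : Pred V 0ℓ
    E     : Rel [ v ∈ V ∣ W v ] 0ℓ
    E-sym : Symmetric E
    E⊆~   : ∀ {u v} → E u v → value u ~ value v

asGraph : ∀ {G} → Subgraph G → Graph
asGraph {G} H = record
  { V        = [ v ∈ Graph.V G ∣ W v ]
  ; _~_      = E
  ; ~-sym    = E-sym
  ; ~-irrefl = λ { refl e → Graph.~-irrefl G refl (E⊆~ e) }
  }
  where open Subgraph H

induced : (G : Graph) → Pred (Graph.V G) 0ℓ → Subgraph G
induced G S = record
  { W     = S
  ; E     = λ u v → value u ~ value v
  ; E-sym = ~-sym
  ; E⊆~   = λ e → e
  }
  where open Graph G

data Walk (G : Graph) : (u v : Graph.V G) → ℕ → Set where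
  nil  : ∀ {u} → Walk G u u 0
  cons : ∀ {u v w k} → Graph._~_ G u w → Walk G w v k → Walk G u v (suc k)

-- A shortest walk is a path, so minimising over walks or over paths gives the
-- same distance.  As a relation, distance makes sense in every graph; no k is
-- related to u and v lying in different components.
IsDistance : (G : Graph) → (u v : Graph.V G) → ℕ → Set
IsDistance G u v k = Walk G u v k × (∀ m → Walk G u v m → k ≤ m)

hypercube : ℕ → Graph
hypercube d = record
  { V        = Vec Bool d
  ; _~_      = λ x y → ∃ λ i → lookup x i ≢ lookup y i
                             × (∀ j → j ≢ i → lookup x j ≡ lookup y j)
  ; ~-sym    = λ (i , x≢y , x≡y) → i , ≢-sym x≢y , λ j j≢i → sym (x≡y j j≢i)
  ; ~-irrefl = λ { refl (i , x≢x , _) → x≢x refl }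
  }

IsIsometric : ∀ {G} → Subgraph G → Set
IsIsometric {G} H = ∀ x y k →
  IsDistance (asGraph H) x y k ⇔ IsDistance G (value x) (value y) k

IsPartialCube : Graph → Set₁
IsPartialCube G =
  ∃ λ d → ∃ λ (H : Subgraph (hypercube d)) → IsIsometric H × (G ≅ asGraph H)

least : {P : ℕ → Set} → Decidable P → ∀ n → P n →
        ∃ λ k → P k × (∀ m → P m → k ≤ m)
least P? zero p = zero , p , λ _ _ → z≤n
least P? (suc n) p with P? zero
... | yes p₀ = zero , p₀ , λ _ _ → z≤n
... | no ¬p₀ = let k , pₖ , k-min = least (P? ∘ suc) n p in
  suc k , pₖ , λ
    { zero    p₀ → contradiction p₀ ¬p₀
    ; (suc m) pₘ → s≤s (k-min m pₘ)
    }

record FiniteConnectedGraph : Set₁ where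
  field
    graph : Graph
  open Graph graph public
  field
    size      : ℕ
    finite    : V ↔ Fin size
    _~?_      : Decidable₂ _~_
    connected : ∀ u v → ∃ (Walk graph u v)

  _≟ⱽ_ : DecidableEquality V
  _≟ⱽ_ = via-injection (↔⇒↣ finite) _≟_

  anyⱽ? : {P : Pred V 0ℓ} → Decidable P → Dec (∃ P)
  anyⱽ? {P} P? =
    map′ (λ (i , p) → from i , p)
         (λ (v , p) → to v , subst P (sym (strictlyInverseʳ v)) p)
         (any? (P? ∘ from))
    where open Inverse finite

  walk? : ∀ k u v → Dec (Walk graph u v k)
  walk? zero    u v = map′ (λ { refl → nil }) (λ { nil → refl }) (u ≟ⱽ v)
  walk? (suc k) u v =
    map′ (λ (_ , e , p) → cons e p) (λ { (cons e p) → _ , e , p })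
         (anyⱽ? (λ w → (u ~? w) ×-dec walk? k w v))

  shortest : ∀ u v → ∃ (IsDistance graph u v)
  shortest u v = let n , p = connected u v in least (λ k → walk? k u v) n p

  dist : V → V → ℕ
  dist u v = proj₁ (shortest u v)

module _ (G : FiniteConnectedGraph) where
  open FiniteConnectedGraph G

  -- Each edge occurs in both orientations; these are always Θ-related.
  record Edge : Set where
    constructor edge
    field
      {src tgt} : V
      adjacent  : src ~ tgt
  open Edge

  Θ : Rel Edge 0ℓ
  Θ e f = dist (src e) (src f) + dist (tgt e) (tgt f)
        ≢ dist (src e) (tgt f) + dist (tgt e) (src f)

  -- A Θ-class is represented by any of its edges: quantification over the
  -- classes is quantification over edges, and two classes are distinct when
  -- their representatives are not Θ-related.  The semicubes of the class of e
  -- are those of e; reversing e interchanges the labels 0 and 1.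
  W⁰ W¹ : Edge → Pred V 0ℓ
  W⁰ e a = dist (src e) a < dist (tgt e) a
  W¹ e a = dist (tgt e) a < dist (src e) a

  -- The semicube of e not containing x.
  W* : Edge → V → Pred V 0ℓ
  W* e x z = (x ∈ W⁰ e × z ∈ W¹ e) ⊎ (x ∈ W¹ e × z ∈ W⁰ e)

  IsOppositeSemicubeIsomorphic : Set
  IsOppositeSemicubeIsomorphic =
    ∀ e → asGraph (induced graph (W⁰ e)) ≅ asGraph (induced graph (W¹ e))

  HasOppositeSemicubeHellyProperty : Set
  HasOppositeSemicubeHellyProperty = ∀ x →
    (∀ e f → ¬ Θ e f → Satisfiable (W* e x ∩ W* f x)) →
    Satisfiable (⋂ Edge (λ e → W* e x))

  IsRelativeAntipode : V → V → Set
  IsRelativeAntipode x y = ∀ z → y ~ z → dist x z ≤ dist x y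

  IsAntipodal : Set
  IsAntipodal = ∀ x → ∃! _≡_ (IsRelativeAntipode x)

{-# OPTIONS --safe #-}
-- Antipodal ⇒ opposite-semicube-isomorphic.  A walk from z that keeps moving
-- away from x can only end at the unique relative antipode x̄ of x, so every z
-- lies on a geodesic from x to x̄.  Hence x ↦ x̄ is an automorphism of G that
-- interchanges the two semicubes of every edge.
--
-- Opposite-semicube-isomorphic ⇒ antipodal.  Opposite semicubes have the same
-- size and, G being bipartite, each contains half of the vertices.  If W*ᵢ(x)
-- and W*ⱼ(x) were disjoint, they would therefore cover V(G), but neither
-- contains x.  So the Helly property yields a vertex separated from x by every
-- edge, and such a vertex is the only relative antipode of x.
module Submission where

open import Defs
open import Data.Bool.Base using (Bool; false; not; _xor_)
open import Data.Bool.Properties using (not-¬; ¬-not; not-distribˡ-xor; not-distribʳ-xor)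
open import Data.Fin.Base using (Fin; zero; suc; punchOut)
open import Data.Fin.Induction using (spo-noetherian)
open import Data.Fin.Properties using (injective⇒≤; punchOut-injective)
  renaming (suc-injective to Fin-suc-injective)
open import Data.Irrelevant using ([_])
open import Data.Nat.Base using (ℕ; zero; suc; _+_; _≤_; _<_; s≤s)
open import Data.Nat.Properties
open import Data.Nat.Solver using (module +-*-Solver)
open import Data.Product using (∃; _×_; _,_; proj₁; proj₂)
open import Data.Refinement using (value; _,_; Refinement-syntax)
  renaming (map to map-refinement)
open import Data.Refinement.Properties using (value-injective)
open import Data.Sum.Base using (_⊎_; inj₁; inj₂)
open import Data.Vec.Base using (Vec; _∷_; lookup; foldr′; tabulate)
open import Data.Vec.Properties using (tabulate∘lookup; tabulate-cong)
open import Function.Base using (_∘_; _on_; flip)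
open import Function.Bundles using (_↔_; _⇔_; Injection; Inverse; Equivalence; mk⇔; mk↔ₛ′)
open import Function.Definitions using (Injective)
open import Function.Properties.Inverse using (↔⇒↣)
open import Induction.WellFounded using (WellFounded; Acc; acc)
open import Level using (0ℓ)
import Relation.Binary.Construct.On as On
open import Relation.Binary.PropositionalEquality
open import Relation.Nullary using (¬_; yes; no; contradiction)
open import Relation.Nullary.Decidable using (_×-dec_; _⊎-dec_; decidable-stable; recompute)
open import Relation.Unary using (Pred; Decidable; Satisfiable; _∈_; _∉_; _∩_; ⋂)

-- Counting and induction on finite types.

module _ {A : Set} {n : ℕ} (finite : A ↔ Fin n) where

  -- Pigeonhole: punching a missed value out of the codomain would give an injection from
  -- `Fin (suc m)` into `Fin m`.
  injective⇒hits : ∀ {f : A → A} → Injective _≡_ _≡_ f → ∀ y → ¬ (∀ x → y ≢ f x)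
  injective⇒hits {f} f-injective y missed =
    go (λ eq → from-injective (f-injective (to-injective eq)))
       (to y) (λ i → missed (from i) ∘ to-injective)
    where
    open Inverse finite

    to-injective : Injective _≡_ _≡_ to
    to-injective = Injection.injective (↔⇒↣ finite)

    from-injective : Injective _≡_ _≡_ from
    from-injective {i} {j} eq =
      trans (sym (strictlyInverseˡ i)) (trans (cong to eq) (strictlyInverseˡ j))

    go : ∀ {m} {g : Fin m → Fin m} → Injective _≡_ _≡_ g → ∀ j → ¬ (∀ i → j ≢ g i)
    go {suc m} g-injective j missed = 1+n≰n (injective⇒≤ {f = λ i → punchOut (missed i)}
      (λ {i} {k} eq → g-injective (punchOut-injective (missed i) (missed k) eq)))

  -- By σ and τ each of P and Q contains at least half of A.
  disjoint-halves-cover : {P Q : Pred A 0ℓ} → Decidable P → {σ τ : A → A} →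
    Injective _≡_ _≡_ σ → Injective _≡_ _≡_ τ →
    (∀ {a} → a ∉ P → σ a ∈ P) → (∀ {a} → a ∉ Q → τ a ∈ Q) →
    (∀ {a} → a ∈ P → a ∉ Q) →
    ∀ x → x ∉ P → ¬ x ∉ Q
  disjoint-halves-cover {P} {Q} P? {σ} {τ} σ-inj τ-inj σ-P τ-Q disjoint x x∉P x∉Q =
    injective⇒hits f-injective (τ x) missed
    where
    -- This map fixes `P` and sends its complement into `Q`, hence outside `P`, so it is injective.
    -- It misses `τ x`, which lies in `Q` and could only be `τ (σ a)` if `x` were `σ a`, a member of
    -- `P`.
    f : A → A
    f a with P? a
    ... | yes _ = a
    ... | no  _ = τ (σ a)

    τσ∉P : ∀ {a} → a ∉ P → τ (σ a) ∉ P
    τσ∉P a∉P p = disjoint p (τ-Q (disjoint (σ-P a∉P)))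

    f-injective : Injective _≡_ _≡_ f
    f-injective {a} {b} eq with P? a | P? b
    ... | yes _   | yes _   = eq
    ... | yes a∈P | no b∉P  = contradiction (subst P eq a∈P) (τσ∉P b∉P)
    ... | no a∉P  | yes b∈P = contradiction (subst P (sym eq) b∈P) (τσ∉P a∉P)
    ... | no _    | no _    = σ-inj (τ-inj eq)

    missed : ∀ a → τ x ≢ f a
    missed a eq with P? a
    ... | yes a∈P = disjoint a∈P (subst Q eq (τ-Q x∉Q))
    ... | no a∉P  = x∉P (subst P (sym (τ-inj eq)) (σ-P a∉P))

  -- On a finite type `h` cannot increase forever. This permits induction towards larger values,
  -- with `h` the distance from a fixed vertex.
  >-wellFounded-on : (h : A → ℕ) → WellFounded (flip (_<_ on h))
  >-wellFounded-on h x = subst (Acc _) (strictlyInverseʳ x) (go (noetherian (to x)))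
    where
    open Inverse finite

    noetherian : WellFounded (flip (_<_ on (h ∘ from)))
    noetherian = spo-noetherian (On.isStrictPartialOrder (h ∘ from) <-isStrictPartialOrder)

    go : ∀ {i} → Acc (flip (_<_ on (h ∘ from))) i → Acc (flip (_<_ on h)) (from i)
    go {i} (acc rs) = acc λ {y} lt →
      subst (Acc _) (strictlyInverseʳ y)
        (go (rs (subst (h (from i) <_) (cong h (sym (strictlyInverseʳ y))) lt)))

-- Operations on walks.

module _ {G : Graph} where
  open Graph G

  infixr 5 _++_
  _++_ : ∀ {u v w k l} → Walk G u v k → Walk G v w l → Walk G u w (k + l)
  nil      ++ q = q
  cons e p ++ q = cons e (p ++ q)

  snoc : ∀ {u v w k} → Walk G u v k → v ~ w → Walk G u w (suc k)
  snoc nil        e = cons e nil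
  snoc (cons d p) e = cons d (snoc p e)

  reverse : ∀ {u v k} → Walk G u v k → Walk G v u k
  reverse nil        = nil
  reverse (cons e p) = snoc (reverse p) (~-sym e)

-- Bipartiteness of partial cubes.

parity : ∀ {d} → Vec Bool d → Bool
parity = foldr′ _xor_ false

lookup-extensional : ∀ {A : Set} {d} {x y : Vec A d} → (∀ i → lookup x i ≡ lookup y i) → x ≡ y
lookup-extensional {x = x} {y} eq =
  trans (sym (tabulate∘lookup x)) (trans (tabulate-cong eq) (tabulate∘lookup y))

parity-alternates : ∀ {d} {x y : Vec Bool d} →
                    Graph._~_ (hypercube d) x y → parity x ≡ not (parity y)
parity-alternates {x = a ∷ x} {b ∷ y} (zero , a≢b , x≡y)
  rewrite lookup-extensional {x = x} {y} (λ i → x≡y (suc i) λ ()) | ¬-not a≢b =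
  sym (not-distribˡ-xor b (parity y))
parity-alternates {x = a ∷ x} {b ∷ y} (suc i , xᵢ≢yᵢ , x≡y)
  rewrite x≡y zero (λ ())
        | parity-alternates {x = x} {y}
            (i , xᵢ≢yᵢ , λ j j≢i → x≡y (suc j) (j≢i ∘ Fin-suc-injective)) =
  sym (not-distribʳ-xor b (parity y))

IsProperColouring : (G : Graph) → (Graph.V G → Bool) → Set
IsProperColouring G c = ∀ {u v} → Graph._~_ G u v → c u ≡ not (c v)

partialCube⇒2-colourable : ∀ {G} → IsPartialCube G → ∃ (IsProperColouring G)
partialCube⇒2-colourable (_ , H , _ , G≅H) =
  parity ∘ value ∘ to ,
  λ {u} {v} e → parity-alternates {x = value (to u)} {value (to v)}
    (Subgraph.E⊆~ H (Equivalence.to (edges u v) e))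
  where open _≅_ G≅H

-- Both walks have length `k` and end at `a`; each of their steps flips the colour.
walk-parity : ∀ {G c} → IsProperColouring G c → ∀ {u v a k} →
              Walk G u a k → Walk G v a k → c u ≡ c v
walk-parity alternates nil        nil        = refl
walk-parity alternates (cons e p) (cons f q) =
  trans (alternates e) (trans (cong not (walk-parity alternates p q)) (sym (alternates f)))

m+n≡o+p∧m<o⇒p<n : ∀ {m n o p} → m + n ≡ o + p → m < o → p < n
m+n≡o+p∧m<o⇒p<n eq m<o = ≰⇒> λ n≤p → <⇒≢ (+-mono-<-≤ m<o n≤p) eq

-- Distance and semicubes.

module _ (G : FiniteConnectedGraph) where
  open FiniteConnectedGraph G

  geodesic : ∀ u v → Walk graph u v (dist u v)
  geodesic u v = proj₁ (proj₂ (shortest u v))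

  dist-minimal : ∀ {u v k} → Walk graph u v k → dist u v ≤ k
  dist-minimal {u} {v} p = proj₂ (proj₂ (shortest u v)) _ p

  dist-sym : ∀ u v → dist u v ≡ dist v u
  dist-sym u v = ≤-antisym (dist-minimal (reverse (geodesic v u)))
                           (dist-minimal (reverse (geodesic u v)))

  dist-refl : ∀ u → dist u u ≡ 0
  dist-refl u = n≤0⇒n≡0 (dist-minimal nil)

  dist-triangle : ∀ u v w → dist u w ≤ dist u v + dist v w
  dist-triangle u v w = dist-minimal (geodesic u v ++ geodesic v w)

  dist-≢0 : ∀ {u v} → u ≢ v → dist u v ≢ 0
  dist-≢0 {u} {v} u≢v eq with dist u v | geodesic u v
  dist-≢0 u≢v refl | .0 | nil = u≢v refl

  dist≡1⇒~ : ∀ {u v} → dist u v ≡ 1 → u ~ v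
  dist≡1⇒~ {u} {v} eq with dist u v | geodesic u v
  dist≡1⇒~ refl | .1 | cons e nil = e

  ~⇒dist≡1 : ∀ {u v} → u ~ v → dist u v ≡ 1
  ~⇒dist≡1 e = ≤-antisym (dist-minimal (cons e nil))
                          (n≢0⇒n>0 (dist-≢0 λ u≡v → ~-irrefl u≡v e))

  closer-neighbour : ∀ {u v} → u ≢ v → ∃ λ w → u ~ w × dist w v < dist u v
  closer-neighbour {u} {v} u≢v with dist u v | geodesic u v
  ... | .0 | nil      = contradiction refl u≢v
  ... | _  | cons e p = _ , e , s≤s (dist-minimal p)

  W⁰? : ∀ e → Decidable (W⁰ G e)
  W⁰? e a = dist (Edge.src e) a <? dist (Edge.tgt e) a

  W¹? : ∀ e → Decidable (W¹ G e)
  W¹? e a = dist (Edge.tgt e) a <? dist (Edge.src e) a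

  W*-irrefl : ∀ e {x} → ¬ W* G e x x
  W*-irrefl e (inj₁ (p , q)) = <-asym p q
  W*-irrefl e (inj₂ (p , q)) = <-asym p q

  W*? : ∀ e x → Decidable (W* G e x)
  W*? e x z = (W⁰? e x ×-dec W¹? e z) ⊎-dec (W¹? e x ×-dec W⁰? e z)

  -- The antipodal map as an automorphism.

  module Antipodal (antipodal : IsAntipodal G) where

    antipode : V → V
    antipode x = proj₁ (antipodal x)

    antipode-unique : ∀ {x y} → IsRelativeAntipode G x y → antipode x ≡ y
    antipode-unique {x} = proj₂ (proj₂ (antipodal x))

    farther-neighbour : ∀ {x y} → antipode x ≢ y → ∃ λ z → y ~ z × dist x y < dist x z
    farther-neighbour {x} {y} x̄≢y =
      decidable-stable (anyⱽ? λ z → (y ~? z) ×-dec (dist x y <? dist x z)) λ none →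
        x̄≢y (antipode-unique λ z e → ≮⇒≥ λ lt → none (z , e , lt))

    -- Induction away from `x`: passing from `z` to a farther neighbour `w` raises the distance from
    -- `x` by at least 1 and lowers the distance to `x̄` by at most 1, so the sum never drops on the
    -- way to `x̄`.
    on-geodesic : ∀ x z → dist x z + dist z (antipode x) ≡ dist x (antipode x)
    on-geodesic x z = ≤-antisym (go (>-wellFounded-on finite (dist x) z)) (dist-triangle x z x̄)
      where
      x̄ = antipode x
      go : ∀ {z} → Acc (flip (_<_ on dist x)) z → dist x z + dist z x̄ ≤ dist x x̄
      go {z} (acc rs) with x̄ ≟ⱽ z
      ... | yes refl = ≤-reflexive (trans (cong (dist x x̄ +_) (dist-refl x̄)) (+-identityʳ _))
      ... | no x̄≢z with farther-neighbour x̄≢z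
      ... | w , e , lt = begin
        dist x z + dist z x̄        ≤⟨ +-monoʳ-≤ (dist x z) (dist-minimal (cons e (geodesic w x̄))) ⟩
        dist x z + suc (dist w x̄)  ≡⟨ +-suc (dist x z) (dist w x̄) ⟩
        suc (dist x z) + dist w x̄  ≤⟨ +-monoˡ-≤ (dist w x̄) lt ⟩
        dist x w + dist w x̄        ≤⟨ go (rs lt) ⟩
        dist x x̄                   ∎
        where open ≤-Reasoning

    -- By `on-geodesic` no vertex is farther from `x̄` than `x` is, so `x` is a relative antipode of
    -- `x̄`.
    antipode-involutive : ∀ x → antipode (antipode x) ≡ x
    antipode-involutive x = antipode-unique λ z _ → begin
      dist x̄ z             ≡⟨ dist-sym x̄ z ⟩
      dist z x̄             ≤⟨ m≤n+m (dist z x̄) (dist x z) ⟩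
      dist x z + dist z x̄  ≡⟨ on-geodesic x z ⟩
      dist x x̄             ≡⟨ dist-sym x x̄ ⟩
      dist x̄ x             ∎
      where
      x̄ = antipode x
      open ≤-Reasoning

    -- Splitting `dist u ū` at `v` and at `v̄`, and `dist v v̄` at `u` and at `ū`, gives two
    -- equations whose sum leaves twice `dist ū v̄` equal to 2.
    antipode-~ : ∀ {u v} → u ~ v → antipode u ~ antipode v
    antipode-~ {u} {v} e = dist≡1⇒~ (double-injective (+-cancelˡ-≡ (dist v ū + dist u v̄) _ _ sum))
      where
      ū = antipode u
      v̄ = antipode v

      double-injective : ∀ {m} → m + m ≡ 2 → m ≡ 1
      double-injective {1} _ = refl
      double-injective {suc (suc m)} eq = contradiction (suc-injective (suc-injective eq)) (m+1+n≢0 m)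

      via-ū : 1 + dist v ū ≡ dist u v̄ + dist ū v̄
      via-ū = begin
        1 + dist v ū           ≡⟨ cong (_+ dist v ū) (~⇒dist≡1 e) ⟨
        dist u v + dist v ū    ≡⟨ on-geodesic u v ⟩
        dist u ū               ≡⟨ on-geodesic u v̄ ⟨
        dist u v̄ + dist v̄ ū    ≡⟨ cong (dist u v̄ +_) (dist-sym v̄ ū) ⟩
        dist u v̄ + dist ū v̄    ∎
        where open ≡-Reasoning

      via-v̄ : 1 + dist u v̄ ≡ dist v ū + dist ū v̄
      via-v̄ = begin
        1 + dist u v̄           ≡⟨ cong (_+ dist u v̄) (~⇒dist≡1 (~-sym e)) ⟨
        dist v u + dist u v̄    ≡⟨ on-geodesic v u ⟩
        dist v v̄               ≡⟨ on-geodesic v ū ⟨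
        dist v ū + dist ū v̄    ∎
        where open ≡-Reasoning

      sum : (dist v ū + dist u v̄) + (dist ū v̄ + dist ū v̄) ≡ (dist v ū + dist u v̄) + 2
      sum = begin
        (c + f) + (g + g)    ≡⟨ solve 3 (λ c f g → (c :+ f) :+ (g :+ g) := (f :+ g) :+ (c :+ g)) refl c f g ⟩
        (f + g) + (c + g)    ≡⟨ cong₂ _+_ via-ū via-v̄ ⟨
        (1 + c) + (1 + f)    ≡⟨ solve 2 (λ c f → (con 1 :+ c) :+ (con 1 :+ f) := (c :+ f) :+ con 2) refl c f ⟩
        (c + f) + 2          ∎
        where
        open ≡-Reasoning
        open +-*-Solver
        c = dist v ū
        f = dist u v̄
        g = dist ū v̄

    -- The distances from any `z` to `a` and to its antipode have a sum independent of `z`, so being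
    -- nearer to one means being farther from the other.
    antipode-reverses : ∀ {x y a} → dist x a < dist y a →
                        dist y (antipode a) < dist x (antipode a)
    antipode-reverses {x} {y} {a} = m+n≡o+p∧m<o⇒p<n (trans (through x) (sym (through y)))
      where
      through : ∀ z → dist z a + dist z (antipode a) ≡ dist a (antipode a)
      through z = trans (cong (_+ dist z (antipode a)) (dist-sym z a)) (on-geodesic a z)

    oppositeSemicubeIsomorphic : IsOppositeSemicubeIsomorphic G
    oppositeSemicubeIsomorphic e = record
      { vertices = mk↔ₛ′ (map-refinement antipode antipode-reverses)
                         (map-refinement antipode antipode-reverses)
                         (λ a → value-injective (antipode-involutive (value a)))
                         (λ a → value-injective (antipode-involutive (value a)))
      ; edges = λ u v → mk⇔ antipode-~
          -- Edges are reflected by applying the antipodal map once more.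
          (subst₂ _~_ (antipode-involutive (value u)) (antipode-involutive (value v)) ∘ antipode-~)
      }

  -- Semicubes in bipartite graphs.

  module Bipartite {c : V → Bool} (alternates : IsProperColouring graph c) where

    -- Geodesics of equal length to `a` would force the same colour on adjacent vertices.
    endpoints-not-equidistant : ∀ {u v} → u ~ v → ∀ a → dist u a ≢ dist v a
    endpoints-not-equidistant {u} {v} e a eq =
      not-¬ (walk-parity alternates (subst (Walk graph u a) eq (geodesic u a)) (geodesic v a))
            (alternates e)

    ≮⇒flip< : ∀ {u v} → u ~ v → ∀ {a} → ¬ dist u a < dist v a → dist v a < dist u a
    ≮⇒flip< e {a} u≮v = ≤∧≢⇒< (≮⇒≥ u≮v) (endpoints-not-equidistant (~-sym e) a)

    W⁰⊎W¹ : ∀ e a → a ∈ W⁰ G e ⊎ a ∈ W¹ G e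
    W⁰⊎W¹ (edge {u} {v} e) a with dist u a <? dist v a
    ... | yes p = inj₁ p
    ... | no ¬p = inj₂ (≮⇒flip< e ¬p)

    -- This makes `swap` carry the complement of `W* G e x` into `W* G e x`, as the counting
    -- argument requires.
    ¬W*-opposite : ∀ e {x a b} → ¬ W* G e x a → W* G e a b → W* G e x b
    ¬W*-opposite e {x} x∼a a*b with W⁰⊎W¹ e x | a*b
    ... | inj₁ x⁰ | inj₁ (a⁰ , b¹) = inj₁ (x⁰ , b¹)
    ... | inj₁ x⁰ | inj₂ (a¹ , b⁰) = contradiction (inj₁ (x⁰ , a¹)) x∼a
    ... | inj₂ x¹ | inj₁ (a⁰ , b¹) = contradiction (inj₂ (x¹ , a⁰)) x∼a
    ... | inj₂ x¹ | inj₂ (a¹ , b⁰) = inj₂ (x¹ , b⁰)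

    module SemicubeSwap (e : Edge G)
      (iso : asGraph (induced graph (W⁰ G e)) ≅ asGraph (induced graph (W¹ G e))) where
      open Inverse (_≅_.vertices iso)

      -- The membership proof in a refinement is irrelevant; decidability recovers a usable one.
      W⁰-holds : (a : [ a ∈ V ∣ W⁰ G e a ]) → value a ∈ W⁰ G e
      W⁰-holds (a , [ p ]) = recompute (W⁰? e a) p

      W¹-holds : (a : [ a ∈ V ∣ W¹ G e a ]) → value a ∈ W¹ G e
      W¹-holds (a , [ p ]) = recompute (W¹? e a) p

      swap : V → V
      swap a with W⁰⊎W¹ e a
      ... | inj₁ p = value (to (a , [ p ]))
      ... | inj₂ p = value (from (a , [ p ]))

      swap-opposite : ∀ a → W* G e a (swap a)
      swap-opposite a with W⁰⊎W¹ e a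
      ... | inj₁ p = inj₁ (p , W¹-holds (to (a , [ p ])))
      ... | inj₂ p = inj₂ (p , W⁰-holds (from (a , [ p ])))

      swap-injective : Injective _≡_ _≡_ swap
      swap-injective {a} {b} eq with W⁰⊎W¹ e a | W⁰⊎W¹ e b
      ... | inj₁ p | inj₁ q = cong value (trans (sym (strictlyInverseʳ _))
            (trans (cong from (value-injective eq)) (strictlyInverseʳ _)))
      -- Vertices from different semicubes have images in different semicubes.
      ... | inj₁ p | inj₂ q = contradiction (W¹-holds (to (a , [ p ])))
            (<-asym (subst (W⁰ G e) (sym eq) (W⁰-holds (from (b , [ q ])))))
      ... | inj₂ p | inj₁ q = contradiction (W⁰-holds (from (a , [ p ])))
            (<-asym (subst (W¹ G e) (sym eq) (W¹-holds (to (b , [ q ])))))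
      ... | inj₂ p | inj₂ q = cong value (trans (sym (strictlyInverseˡ _))
            (trans (cong to (value-injective eq)) (strictlyInverseˡ _)))

    W*-intersect : IsOppositeSemicubeIsomorphic G →
                   ∀ x e f → Satisfiable (W* G e x ∩ W* G f x)
    W*-intersect iso x e f =
      decidable-stable (anyⱽ? λ z → W*? e x z ×-dec W*? f x z) λ empty →
        disjoint-halves-cover finite (W*? e x)
          E.swap-injective F.swap-injective
          (λ {a} a∉ → ¬W*-opposite e a∉ (E.swap-opposite a))
          (λ {a} a∉ → ¬W*-opposite f a∉ (F.swap-opposite a))
          (λ {a} a∈ a∈′ → empty (a , a∈ , a∈′))
          x (W*-irrefl e) (W*-irrefl f)
      where
      module E = SemicubeSwap e (iso e)
      module F = SemicubeSwap f (iso f)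

  -- From separated vertices to relative antipodes.

  W*-separates : ∀ {x z u v} → (∀ e → W* G e x z) → u ~ v →
                 dist v z < dist u z → dist x u < dist x v
  -- The edge `uv` itself separates `x` from `z`: since `z` is on the side of `v`, `x` is on the
  -- side of `u`. Thus a step towards `z` leads away from `x`.
  W*-separates {x} {z} {u} {v} z∈W* e v<u with z∈W* (edge e)
  ... | inj₁ (u<v , _) = subst₂ _<_ (dist-sym u x) (dist-sym v x) u<v
  ... | inj₂ (_ , u<v) = contradiction u<v (<-asym v<u)

  separated⇒antipodal : (∀ x → Satisfiable (⋂ (Edge G) (λ e → W* G e x))) → IsAntipodal G
  separated⇒antipodal separated x with separated x
  ... | z , z∈W* = z , z-antipode , unique
    where
    z-antipode : IsRelativeAntipode G x z
    -- Stepping from a neighbour `w` to `z` approaches `z`, so `w` is nearer to `x` than `z` is.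
    z-antipode w z~w = <⇒≤ (W*-separates z∈W* (~-sym z~w)
      (subst (_< dist w z) (sym (dist-refl z))
        (n≢0⇒n>0 (dist-≢0 λ w≡z → ~-irrefl w≡z (~-sym z~w)))))

    unique : ∀ {y} → IsRelativeAntipode G x y → z ≡ y
    unique {y} y-antipode = decidable-stable (z ≟ⱽ y) λ z≢y →
      -- If `y` differs from `z`, its neighbour towards `z` is farther from `x`, so `y` is no
      -- relative antipode.
      let w , y~w , w<y = closer-neighbour (z≢y ∘ sym) in
      ≤⇒≯ (y-antipode w y~w) (W*-separates z∈W* y~w w<y)

theorem5p4 : (G : FiniteConnectedGraph) →
    IsPartialCube (FiniteConnectedGraph.graph G) →
    HasOppositeSemicubeHellyProperty G →
    IsAntipodal G ⇔ IsOppositeSemicubeIsomorphic G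
theorem5p4 G partialCube helly = mk⇔
  (Antipodal.oppositeSemicubeIsomorphic G)
  (λ iso → separated⇒antipodal G λ x →
    helly x λ e f _ → Bipartite.W*-intersect G alternates iso x e f)
  where
  alternates = proj₂ (partialCube⇒2-colourable partialCube)
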